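{- For each positive integer $k$, for all sufficiently large $n$, the edges of $G(n)$ cannot be covered by complete bipartite subgraphs of $G(n)$ in such a way that each vertex belongs to at most $k$ of these subgraphs.
   Context: For a positive integer $n$, $G(n)$ is the bipartite graph with vertices $x_1,\ldots,x_n$ and $y_1,\ldots,y_n$ whose edges are the pairs $x_iy_j$ with $i\le j$. A family of subgraphs covers the edges of $G(n)$ if every edge of $G(n)$ belongs to at least one of the subgraphs (an edge may be covered more than once). -}

module Defs where

open import Data.Bool.Base using (Bool)
open import Data.Empty using (⊥)
open import Data.Fin.Base using (Fin; _≤_)
open import Data.List.Base using (List; filter; length)
open import Data.List.Relation.Unary.All using (All)
open import Data.List.Relation.Unary.Any using (Any)
open import Data.Nat.Base as ℕ using (ℕ)
open import Data.Product.Base using (Σ-syntax; _×_)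
open import Data.Sum.Base using (_⊎_; inj₁; inj₂)
open import Function.Bundles using (_⇔_)
open import Level using (0ℓ)
open import Relation.Binary.Core using (Rel)
import Relation.Binary.Definitions as B
open import Relation.Binary.PropositionalEquality using (_≢_)
open import Relation.Nullary using (¬_)
open import Relation.Unary using (Pred; Decidable)

record SimpleGraph (V : Set) : Set₁ where
  field
    Adj     : Rel V 0ℓ
    sym     : B.Symmetric Adj
    irrefl  : ∀ v → ¬ Adj v v

-- Vertex and edge membership are decidable so that subgraphs can be counted.
record Subgraph {V : Set} (Γ : SimpleGraph V) : Set₁ where
  field
    Vertex      : Pred V 0ℓ
    vertex?     : Decidable Vertex
    Edge        : Rel V 0ℓ
    edge?       : B.Decidable Edge
    edge-sym    : B.Symmetric Edge
    edge-adj    : ∀ {u v} → Edge u v → SimpleGraph.Adj Γ u v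
    edge-vertex : ∀ {u v} → Edge u v → Vertex u

open Subgraph public using (Vertex; vertex?; Edge)

-- The Boolean colouring splits the vertices of H into its two parts; its
-- values outside H are irrelevant. A part may be empty, in which case H has
-- no edges and covers nothing.
CompleteBipartite : {V : Set} {Γ : SimpleGraph V} → Subgraph Γ → Set
CompleteBipartite {V} H =
  Σ[ side ∈ (V → Bool) ]
    (∀ u v → Vertex H u → Vertex H v → Edge H u v ⇔ side u ≢ side v)

CoversEdges : {V : Set} (Γ : SimpleGraph V) → List (Subgraph Γ) → Set₁
CoversEdges Γ ℱ = ∀ u v → SimpleGraph.Adj Γ u v → Any (λ H → Edge H u v) ℱ

-- Families are lists, so a repeated subgraph is counted with multiplicity;
-- removing repetitions preserves covering and never increases this number.
multiplicity : {V : Set} {Γ : SimpleGraph V} → List (Subgraph Γ) → V → ℕ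
multiplicity ℱ v = length (filter (λ H → vertex? H v) ℱ)

-- inj₁ i is the vertex xᵢ and inj₂ j is the vertex yⱼ, with indices shifted
-- to start at 0.
G : (n : ℕ) → SimpleGraph (Fin n ⊎ Fin n)
G n = record { Adj = Adj ; sym = λ {u} {v} → sym u v ; irrefl = irrefl }
  where
  Adj : Rel (Fin n ⊎ Fin n) 0ℓ
  Adj (inj₁ i) (inj₂ j) = i ≤ j
  Adj (inj₂ j) (inj₁ i) = i ≤ j
  Adj (inj₁ _) (inj₁ _) = ⊥
  Adj (inj₂ _) (inj₂ _) = ⊥

  sym : ∀ u v → Adj u v → Adj v u
  sym (inj₁ _) (inj₂ _) e = e
  sym (inj₂ _) (inj₁ _) e = e

  irrefl : ∀ v → ¬ Adj v v
  irrefl (inj₁ _) ()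
  irrefl (inj₂ _) ()

HasCompleteBipartiteCover : {V : Set} → SimpleGraph V → ℕ → Set₁
HasCompleteBipartiteCover Γ k =
  Σ[ ℱ ∈ List (Subgraph Γ) ]
    All CompleteBipartite ℱ × CoversEdges Γ ℱ × (∀ v → multiplicity ℱ v ℕ.≤ k)

{-# OPTIONS --safe #-}
module Submission where

-- Let i₁ < i₂ < … be indices whose mutual edges are covered. The at most k
-- subgraphs through the first x-vertex x cover all the edges x y_j, so by
-- pigeonhole one of them, h, contains x y_j for many j. Let j₀ be the least such
-- j. A subgraph that contains x y_{j₀} contains no edge x_i y_j with i > j₀,
-- since completeness would give it x_i y_{j₀}, which is not an edge of G(n).
-- Discarding all subgraphs that contain x y_{j₀} therefore keeps the edges among
-- the remaining indices covered, and it lowers the multiplicity of each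
-- remaining y_j, because h is discarded. After k rounds no subgraph contains any
-- remaining y_j.

open import Data.Empty using (⊥)
open import Data.Fin.Base as Fin using (Fin)
import Data.Fin.Properties as Fin
open import Data.List.Base using (List; []; _∷_; filter; length; allFin)
open import Data.List.Membership.Propositional using (_∈_; find; lose)
open import Data.List.Membership.Propositional.Properties
  using (∈-filter⁺; ∈-filter⁻)
open import Data.List.Properties
  using (length-filter; filter-notAll; filter-some; length-tabulate)
open import Data.List.Relation.Unary.All as All using (All; []; _∷_)
import Data.List.Relation.Unary.All.Properties as All
open import Data.List.Relation.Unary.AllPairs using (AllPairs; _∷_)
import Data.List.Relation.Unary.AllPairs.Properties as AllPairs
open import Data.List.Relation.Unary.Any as Any using (Any; here; there)
open import Data.Nat.Base using (ℕ; zero; suc; _+_; _*_; _≤_; _<_; s≤s⁻¹)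
open import Data.Nat.Properties
open import Data.Product.Base using (∃-syntax; _×_; _,_; proj₁; proj₂)
open import Data.Sum.Base using (inj₁; inj₂)
open import Function.Base using (_∘_)
open import Function.Bundles using (Equivalence)
open import Level using (Level; 0ℓ)
open import Relation.Binary.PropositionalEquality
open import Relation.Nullary using (¬_; yes; no; ¬?; contradiction)
open import Relation.Unary using (Pred; Decidable)
open import Defs

private
  variable
    a b p q : Level
    A : Set a
    B : Set b

module _ {P : Pred A p} {Q : Pred A q} (P? : Decidable P) (Q? : Decidable Q) where

  filter-swap : ∀ xs → filter P? (filter Q? xs) ≡ filter Q? (filter P? xs)
  filter-swap [] = refl
  filter-swap (x ∷ xs) with P? x in eqP | Q? x in eqQ
  ... | yes _ | yes _ rewrite eqP | eqQ = cong (x ∷_) (filter-swap xs)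
  ... | yes _ | no  _ rewrite eqQ       = filter-swap xs
  ... | no  _ | yes _ rewrite eqP       = filter-swap xs
  ... | no  _ | no  _                   = filter-swap xs

module _ {P : Pred A p} (P? : Decidable P) where

  length-filter-∁ : ∀ xs →
    length xs ≡ length (filter P? xs) + length (filter (¬? ∘ P?) xs)
  length-filter-∁ [] = refl
  length-filter-∁ (x ∷ xs) with P? x
  ... | yes _ = cong suc (length-filter-∁ xs)
  ... | no  _ = trans (cong suc (length-filter-∁ xs)) (sym (+-suc _ _))

module _ {Q : A → Pred B q} (Q? : ∀ h → Decidable (Q h)) where

  -- Induction on the list of holes: if `h` meets at most `c` entries, discarding these leaves more
  -- than `length hs * c` entries, each met by a member of `hs`.
  pigeonhole : ∀ c hs xs → All (λ x → Any (λ h → Q h x) hs) xs →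
    length hs * c < length xs → Any (λ h → c < length (filter (Q? h) xs)) hs
  pigeonhole c []       (x ∷ xs) (() ∷ _) _
  pigeonhole c (h ∷ hs) xs hits large with c <? length (filter (Q? h) xs)
  ... | yes many = here many
  ... | no  few  = there (Any.map enlarge
    (pigeonhole c hs rest restHits (+-cancelˡ-< c _ _ restLarge)))
    where
    rest = filter (¬? ∘ Q? h) xs

    restHits : All (λ x → Any (λ h → Q h x) hs) rest
    restHits = All.zipWith
      (λ { (¬Qhx , here Qhx) → contradiction Qhx ¬Qhx ; (_ , there hit) → hit })
      (All.all-filter (¬? ∘ Q? h) xs , All.filter⁺ (¬? ∘ Q? h) hits)

    restLarge : c + length hs * c < c + length rest
    restLarge = begin-strict
      c + length hs * c                        <⟨ large ⟩
      length xs                                ≡⟨ length-filter-∁ (Q? h) xs ⟩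
      length (filter (Q? h) xs) + length rest  ≤⟨ +-monoˡ-≤ _ (≮⇒≥ few) ⟩
      c + length rest                          ∎
      where open ≤-Reasoning

    enlarge : ∀ {h′} → c < length (filter (Q? h′) rest) →
              c < length (filter (Q? h′) xs)
    enlarge {h′} c< = <-≤-trans c< (begin
      length (filter (Q? h′) rest)                    ≡⟨ cong length (filter-swap (Q? h′) (¬? ∘ Q? h) xs) ⟩
      length (filter (¬? ∘ Q? h) (filter (Q? h′) xs)) ≤⟨ length-filter (¬? ∘ Q? h) (filter (Q? h′) xs) ⟩
      length (filter (Q? h′) xs)                      ∎)
      where open ≤-Reasoning

module _ {V : Set} {Γ : SimpleGraph V} {R : Pred (Subgraph Γ) 0ℓ} (R? : Decidable R) where

  multiplicity-filter-≤ : ∀ ℱ v → multiplicity (filter R? ℱ) v ≤ multiplicity ℱ v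
  multiplicity-filter-≤ ℱ v
    -- Multiplicity is itself the length of a filter; swapping the two filters puts the discarding
    -- outermost.
    rewrite filter-swap (λ H → vertex? H v) R? ℱ =
    length-filter R? (filter (λ H → vertex? H v) ℱ)

  multiplicity-filter-< : ∀ {ℱ v H} → H ∈ ℱ → Vertex H v → ¬ R H →
    multiplicity (filter R? ℱ) v < multiplicity ℱ v
  multiplicity-filter-< {ℱ} {v} H∈ℱ v∈H ¬RH
    rewrite filter-swap (λ H → vertex? H v) R? ℱ =
    filter-notAll R? (filter (λ H → vertex? H v) ℱ)
      (lose (∈-filter⁺ (λ H → vertex? H v) H∈ℱ v∈H) ¬RH)

module _ {n : ℕ} where

  XY : Subgraph (G n) → Fin n → Fin n → Set
  XY H i j = Edge H (inj₁ i) (inj₂ j)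

  XY? : ∀ H i → Decidable (XY H i)
  XY? H i j = Subgraph.edge? H (inj₁ i) (inj₂ j)

  y-vertex : ∀ H {i j} → XY H i j → Vertex H (inj₂ j)
  y-vertex H = Subgraph.edge-vertex H ∘ Subgraph.edge-sym H

  -- No edge of `G n` joins two x-vertices, so all x-vertices of `H` share one side, opposite to
  -- `inj₂ j′` because of the second edge.
  XY-rectangular : ∀ H → CompleteBipartite H →
    ∀ {i j i′ j′} → XY H i j → XY H i′ j′ → XY H i j′
  XY-rectangular H (side , complete) {i} {j} {i′} {j′} e e′ =
    Equivalence.from (complete (inj₁ i) (inj₂ j′) x y′) λ same →
      Subgraph.edge-adj H (Equivalence.from (complete (inj₁ i) (inj₁ i′) x x′)
        λ same′ → Equivalence.to (complete (inj₁ i′) (inj₂ j′) x′ y′) e′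
          (trans (sym same′) same))
    where
    x  = Subgraph.edge-vertex H e
    x′ = Subgraph.edge-vertex H e′
    y′ = y-vertex H e′

-- This is k + k² + ... + k^b. The factor `k` pays for the pigeonhole step, the `suc` for the index
-- `j₀` spent in each round.
coverBound : ℕ → ℕ → ℕ
coverBound k zero    = 0
coverBound k (suc b) = k * suc (coverBound k b)

-- Induction on `b`. The two multiplicity bounds are separate because only the one at the y-vertices
-- drops; the bound `k` at the x-vertices feeds the pigeonhole in every round.
coverBound-sound : ∀ {n} k b (ℱ : List (Subgraph (G n))) (is : List (Fin n)) →
  AllPairs Fin._<_ is →
  All CompleteBipartite ℱ →
  (∀ i → multiplicity ℱ (inj₁ i) ≤ k) →
  (∀ {j} → j ∈ is → multiplicity ℱ (inj₂ j) ≤ b) →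
  (∀ {i j} → i ∈ is → j ∈ is → i Fin.≤ j → Any (λ H → XY H i j) ℱ) →
  ¬ coverBound k b < length is
-- The diagonal edge at `i` is covered, so some subgraph contains `inj₂ i`, against multiplicity 0.
coverBound-sound k zero ℱ (i ∷ _) _ _ _ y≤ covers _ =
  <⇒≱ (filter-some (λ H → vertex? H (inj₂ i))
        (Any.map (λ {H} → y-vertex H) (covers (here refl) (here refl) Fin.≤-refl)))
      (y≤ (here refl))
coverBound-sound {n} k (suc b) ℱ is@(i₁ ∷ _) sorted@(i₁< ∷ _) bicliques x≤ y≤ covers large
  with find (pigeonhole (λ H → XY? H i₁) c through is hits
         -- The length of `through` is the multiplicity of `inj₁ i₁`, hence at most `k`.
         (≤-<-trans (*-monoˡ-≤ c (x≤ i₁)) large))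
  where
  c = suc (coverBound k b)
  through = filter (λ H → vertex? H (inj₁ i₁)) ℱ

  hit : ∀ {j} → j ∈ is → i₁ Fin.≤ j → Any (λ H → XY H i₁ j) through
  hit j∈is i₁≤j with H , H∈ℱ , e ← find (covers (here refl) j∈is i₁≤j) =
    lose (∈-filter⁺ (λ H → vertex? H (inj₁ i₁)) H∈ℱ (Subgraph.edge-vertex H e)) e

  hits : All (λ j → Any (λ H → XY H i₁ j) through) is
  hits = All.tabulate λ where
    (here refl)   → hit (here refl) Fin.≤-refl
    (there j∈is) → hit (there j∈is) (<⇒≤ (All.lookup i₁< j∈is))
... | h , h∈through , many =
  descend (filter (XY? h i₁) is) (AllPairs.filter⁺ (XY? h i₁) sorted)
    (∈-filter⁻ (XY? h i₁)) many
  where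
  h∈ℱ = proj₁ (∈-filter⁻ (λ H → vertex? H (inj₁ i₁)) {xs = ℱ} h∈through)

  -- Generalising the filtered list to `js` allows matching on its head `j₀`, its least index by
  -- sortedness.
  descend : ∀ js → AllPairs Fin._<_ js → (∀ {j} → j ∈ js → j ∈ is × XY h i₁ j) →
    suc (coverBound k b) < length js → ⊥
  descend (j₀ ∷ js) (j₀< ∷ js-sorted) sound long =
    coverBound-sound k b (filter R? ℱ) js js-sorted
      (All.filter⁺ R? bicliques)
      (λ i → ≤-trans (multiplicity-filter-≤ R? ℱ (inj₁ i)) (x≤ i))
      (λ j∈js → let j∈is , e = sound (there j∈js) in
        s≤s⁻¹ (≤-trans
          -- The discarded `h` contains every remaining y-vertex.
          (multiplicity-filter-< R? h∈ℱ (y-vertex h e) (λ ¬e₀ → ¬e₀ (proj₂ (sound (here refl)))))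
          (y≤ j∈is)))
      covers′
      (s≤s⁻¹ long)
    where
    R? : Decidable (λ H → ¬ XY H i₁ j₀)
    R? H = ¬? (XY? H i₁ j₀)

    covers′ : ∀ {i j} → i ∈ js → j ∈ js → i Fin.≤ j → Any (λ H → XY H i j) (filter R? ℱ)
    covers′ i∈js j∈js i≤j
      with H , H∈ℱ , e ← find (covers (proj₁ (sound (there i∈js))) (proj₁ (sound (there j∈js))) i≤j) =
      lose (∈-filter⁺ R? H∈ℱ λ e₀ →
        <⇒≱ (All.lookup j₀< i∈js)
            (Subgraph.edge-adj H (XY-rectangular H (All.lookup bicliques H∈ℱ) e e₀))) e

theorem1p4 : ∀ (k : ℕ) → 1 ≤ k →
    ∃[ N ] (∀ (n : ℕ) → N ≤ n → ¬ HasCompleteBipartiteCover (G n) k)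
-- Initially `k` bounds the multiplicities on both sides, so there are `k` rounds; `suc` makes the
-- length inequality strict.
theorem1p4 k _ = suc (coverBound k k) , λ n large (ℱ , bicliques , covers , mult≤k) →
  coverBound-sound k k ℱ (allFin n) (AllPairs.tabulate⁺-< (λ i<j → i<j)) bicliques
    (λ i → mult≤k (inj₁ i)) (λ {j} _ → mult≤k (inj₂ j))
    (λ {i} {j} _ _ → covers (inj₁ i) (inj₂ j))
    (subst (coverBound k k <_) (sym (length-tabulate {n = n} (λ i → i))) large)
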